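{- Let $I$ be an SF instance and let $\Pi$ be a GSP of $I$. Let $\mathcal{O}_I=\{\Pi_r\in\Pi : |A_r| \text{ is odd}\}$ be the set of cyclic permutations of odd length contained in $\Pi$. Then $\mathcal{O}_I$ is invariant: for every GSP $\Pi'$ of $I$, $\mathcal{O}_I\subseteq\Pi'$.
   Context: A Stable Fixtures (SF) instance is $I=(A,\succ,c)$ where $A=\{a_1,\dots,a_n\}$ is a finite set of $n$ agents; each agent $a_i$ has a strict linear order $\succ_i$ over $A\setminus\{a_i\}$ (complete preference list), with the convention that every agent ranks itself last ($a_j\succ_i a_i$ for all $j\neq i$); $a\succeq_i b$ means $a\succ_i b$ or $a=b$. Each agent has an integer capacity $c_i$ with $1\le c_i<n$. A cyclic permutation of a nonempty set $A_r\subseteq A$ is a permutation $\Pi_r$ of $A_r$ consisting of a single cycle of length $|A_r|$ (length 1: a fixed point $(a_i)$; length 2: a transposition $(a_i\ a_j)$). Two cyclic permutations are distinct if some element is mapped to different elements by them. A GSP (generalised stable partition) of $I$ is a finite collection $\Pi=\{\Pi_1,\dots,\Pi_k\}$ of cyclic permutations $\Pi_r$ of sets $A_r\subseteq A$, pairwise distinct except that fixed points may be repeated, such that: (F1) for every $r$ and every $a_j\in A_r$, $\Pi_r(a_j)\succeq_j\Pi_r^{ -1}(a_j)$; (F2) there are no distinct $a_i,a_j\in A$ with the transposition $(a_i\ a_j)\notin\Pi$ such that $a_j\succ_i\Pi_r^{ -1}(a_i)$ and $a_i\succ_j\Pi_s^{ -1}(a_j)$ for some $\Pi_r,\Pi_s\in\Pi$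 with $a_i\in A_r$, $a_j\in A_s$; (F3) for every $a_i\in A$, the number of indices $r$ with $a_i\in A_r$ equals $c_i$; (F4) for all distinct $a_i,a_j\in A$, $|\{s:\Pi_s(a_i)=a_j\}|+|\{s:\Pi_s(a_j)=a_i\}|\le 2$. Cyclic permutations are compared as functions (so e.g. $(a_1\ a_2\ a_3)=(a_2\ a_3\ a_1)$). -}

module Defs where

open import Data.Nat using (ℕ; _+_; _≤_; _<_; _%_)
open import Data.Fin using (Fin; _≟_)
open import Data.Bool using (if_then_else_)
open import Data.Maybe using (Maybe; just; nothing)
import Data.Maybe.Properties as MaybeP
open import Data.List using (List; []; _∷_; length; filter; lookup)
open import Data.List.Relation.Unary.All using (All)
open import Data.List.Relation.Unary.Unique.Propositional using (Unique)
open import Data.List.Membership.Propositional using (_∈_)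
open import Data.Product using (Σ; ∃; _×_; _,_)
open import Function.Definitions using (Injective)
open import Relation.Binary.PropositionalEquality using (_≡_; _≢_)
open import Relation.Nullary using (¬_; does)

-- An SF instance with n agents, agents are Fin n.
-- Preferences of agent i are encoded by an injective rank function
-- rank i : Fin n → ℕ (smaller rank = more preferred), i.e. a strict
-- linear order on all agents, in which i itself is ranked last.
record SF (n : ℕ) : Set where
  field
    rank     : Fin n → Fin n → ℕ
    rank-inj : ∀ i → Injective _≡_ _≡_ (rank i)
    selfLast : ∀ i j → j ≢ i → rank i j < rank i i
    cap      : Fin n → ℕ
    cap-pos  : ∀ i → 1 ≤ cap i
    cap-lt   : ∀ i → cap i < n

module _ {n : ℕ} where

  Prefers : SF n → Fin n → Fin n → Fin n → Set
  Prefers I i b a = SF.rank I i b < SF.rank I i a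

  PrefersEq : SF n → Fin n → Fin n → Fin n → Set
  PrefersEq I i b a = SF.rank I i b ≤ SF.rank I i a

  -- A cyclic permutation of A_r is written as a duplicate-free nonempty
  -- list [x₀, …, x_{m-1}] meaning x₀ ↦ x₁ ↦ … ↦ x_{m-1} ↦ x₀.
  WFCycle : List (Fin n) → Set
  WFCycle c = Unique c × Σ (Fin n) (λ x → Σ (List (Fin n)) (λ xs → c ≡ x ∷ xs))

  private
    go : Fin n → List (Fin n) → Fin n → Maybe (Fin n)
    go h [] x = nothing
    go h (a ∷ []) x = if does (a ≟ x) then just h else nothing
    go h (a ∷ b ∷ rest) x = if does (a ≟ x) then just b else go h (b ∷ rest) x

  cyc : List (Fin n) → Fin n → Maybe (Fin n)
  cyc [] x = nothing
  cyc (a ∷ as) x = go a (a ∷ as) x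

  SameCycle : List (Fin n) → List (Fin n) → Set
  SameCycle c d = ∀ x → cyc c x ≡ cyc d x

  _∈Π_ : List (Fin n) → List (List (Fin n)) → Set
  c ∈Π Π = Σ (Fin (length Π)) (λ r → SameCycle c (lookup Π r))

  countMaps : List (List (Fin n)) → Fin n → Fin n → ℕ
  countMaps Π i j = length (filter (λ c → MaybeP.≡-dec _≟_ (cyc c i) (just j)) Π)

  countIn : List (List (Fin n)) → Fin n → ℕ
  countIn Π i = length (filter (λ c → Data.List.Membership.DecPropositional._∈?_ _≟_ i c) Π)
    where import Data.List.Membership.DecPropositional

  WouldPrefer : SF n → List (List (Fin n)) → Fin n → Fin n → Set
  WouldPrefer I Π i j =
    Σ (Fin (length Π)) (λ r → Σ (Fin n) (λ z → cyc (lookup Π r) z ≡ just i × Prefers I i j z))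

  record GSP (I : SF n) (Π : List (List (Fin n))) : Set where
    field
      wf       : All WFCycle Π
      distinct : ∀ (r s : Fin (length Π)) → r ≢ s →
                 SameCycle (lookup Π r) (lookup Π s) → length (lookup Π r) ≡ 1
      F1       : ∀ (r : Fin (length Π)) (x y z : Fin n) →
                 cyc (lookup Π r) x ≡ just y → cyc (lookup Π r) z ≡ just x →
                 PrefersEq I x y z
      F2       : ∀ (i j : Fin n) → i ≢ j → ¬ ((i ∷ j ∷ []) ∈Π Π) →
                 ¬ (WouldPrefer I Π i j × WouldPrefer I Π j i)
      F3       : ∀ (i : Fin n) → countIn Π i ≡ SF.cap I i
      F4       : ∀ (i j : Fin n) → i ≢ j → countMaps Π i j + countMaps Π j i ≤ 2

{-# OPTIONS --safe #-}

-- Read Π as the matrix x i j = #{r : Π_r(a_i) = a_j}, i.e. as a many-to-many matching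
-- of the bipartite double cover of the agents.  Outside transpositions, (F1) and (F2)
-- make the predecessor of an agent its worst partner, so each agent lies on at most
-- one cycle of length at least 3; the matching and its transpose are both stable.
-- As for stable matchings, if an arc is lost between two stable matrices, then exactly
-- one of its two ends is better off.  Comparing y (from Π′) with x and with the transpose
-- of x along a cycle p → i → j of Π of length at least 3 gives the following dichotomy.
-- If y has an arc of the cycle but not its reverse, then the same holds at the next arc,
-- so the whole cycle is in Π′.  Otherwise the agents v on the cycle alternate between
-- having all y-partners better than their x-predecessor and having a y-successor at most
-- as good as it, so the cycle has even length.  Loops cannot be lost, because both ends
-- of a loop rank it last; this settles the fixed points.
module Submission where

open import Defs
open import Data.Nat using (ℕ; zero; suc; _+_; _*_; _∸_; _%_; _≤_; _<_; _<?_; _≤?_; z≤n; s≤s; z<s; s<s; s<s⁻¹)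
open import Data.Nat.Properties renaming (_≟_ to _≟ℕ_)
open import Data.Nat.Tactic.RingSolver using (solve-∀)
open import Data.Fin using (Fin; zero; suc; _≟_)
open import Data.Fin.Properties using (any?; all?) renaming (suc-injective to Fin-suc-injective)
open import Data.Maybe using (Maybe; just; nothing)
import Data.Maybe.Properties as Maybe
open import Data.List using (List; []; _∷_; length; filter; lookup)
open import Data.List.Relation.Unary.All as All using (All; []; _∷_)
open import Data.List.Relation.Unary.AllPairs using ([]; _∷_)
open import Data.List.Relation.Unary.Any as Any using (here; there)
open import Data.List.Relation.Unary.Any.Properties using (lookup-index)
open import Data.List.Relation.Unary.Unique.Propositional using (Unique)
open import Data.List.Membership.Propositional using (_∈_; _∉_)
open import Data.List.Membership.Propositional.Properties using (∈-lookup)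
open import Data.List.Membership.DecPropositional using (_∈?_)
open import Data.Product using (∃; _×_; _,_; proj₁; proj₂)
open import Data.Sum using (_⊎_; inj₁; inj₂; map; swap; [_,_]′)
open import Function using (_∘_; flip)
open import Function.Definitions using (Injective)
open import Relation.Binary.PropositionalEquality using (_≡_; _≢_; refl; sym; trans; cong; cong₂; subst; subst₂; module ≡-Reasoning)
open import Relation.Nullary using (¬_; Dec; yes; no; contradiction)
open import Relation.Nullary.Decidable using (_×-dec_; _→-dec_)
open import Relation.Unary using (Decidable)
open import Algebra.Properties.Semiring.Sum +-*-semiring using (sum; sum-cong-≗; ∑-distrib-+; ∑-comm; *-distribʳ-sum)

-- Finite sums over agents and pairs of agents.

Matrix : ℕ → Set
Matrix n = Fin n → Fin n → ℕ

sum-mono : ∀ {n} {f g : Fin n → ℕ} → (∀ i → f i ≤ g i) → sum f ≤ sum g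
sum-mono {zero} le = z≤n
sum-mono {suc n} le = +-mono-≤ (le zero) (sum-mono (le ∘ suc))

sum-pinch : ∀ {n} {f g : Fin n → ℕ} → (∀ i → f i ≤ g i) → sum g ≤ sum f → ∀ i → f i ≡ g i
sum-pinch {suc n} {f} {g} le ge zero =
  ≤-antisym (le zero) (+-cancelʳ-≤ (sum (f ∘ suc)) _ _
    (≤-trans (+-monoʳ-≤ (g zero) (sum-mono (le ∘ suc))) ge))
sum-pinch {suc n} {f} {g} le ge (suc i) =
  sum-pinch (le ∘ suc) (+-cancelˡ-≤ (f zero) _ _ (≤-trans (+-monoˡ-≤ _ (le zero)) ge)) i

-- Both sides are the maximum of `m` and `n`.
m+[n∸m]≡n+[m∸n] : ∀ m n → m + (n ∸ m) ≡ n + (m ∸ n)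
m+[n∸m]≡n+[m∸n] zero    zero    = refl
m+[n∸m]≡n+[m∸n] zero    (suc n) = sym (+-identityʳ (suc n))
m+[n∸m]≡n+[m∸n] (suc m) zero    = +-identityʳ (suc m)
m+[n∸m]≡n+[m∸n] (suc m) (suc n) = cong suc (m+[n∸m]≡n+[m∸n] m n)

-- Truncated differences split a change into gains and losses; equal totals make the two balance.
sum-∸ : ∀ {n} (f g : Fin n → ℕ) → sum f ≡ sum g → sum (λ j → g j ∸ f j) ≡ sum (λ j → f j ∸ g j)
sum-∸ f g eq = +-cancelˡ-≡ (sum f) _ _ (begin
  sum f + sum (λ j → g j ∸ f j)     ≡⟨ ∑-distrib-+ f _ ⟨
  sum (λ j → f j + (g j ∸ f j))     ≡⟨ sum-cong-≗ (λ j → m+[n∸m]≡n+[m∸n] (f j) (g j)) ⟩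
  sum (λ j → g j + (f j ∸ g j))     ≡⟨ ∑-distrib-+ g _ ⟩
  sum g + sum (λ j → f j ∸ g j)     ≡⟨ cong (_+ sum (λ j → f j ∸ g j)) eq ⟨
  sum f + sum (λ j → f j ∸ g j)     ∎)
  where open ≡-Reasoning

∑∑ : ∀ {n} → Matrix n → ℕ
∑∑ f = sum (λ i → sum (f i))

∑∑-distrib-+ : ∀ {n} (f g : Matrix n) → ∑∑ (λ i j → f i j + g i j) ≡ ∑∑ f + ∑∑ g
∑∑-distrib-+ f g = trans (sum-cong-≗ (λ i → ∑-distrib-+ (f i) (g i))) (∑-distrib-+ (sum ∘ f) (sum ∘ g))

∑∑-mono : ∀ {n} {f g : Matrix n} → (∀ i j → f i j ≤ g i j) → ∑∑ f ≤ ∑∑ g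
∑∑-mono le = sum-mono (λ i → sum-mono (le i))

∑∑-pinch : ∀ {n} {f g : Matrix n} → (∀ i j → f i j ≤ g i j) → ∑∑ g ≤ ∑∑ f → ∀ i j → f i j ≡ g i j
∑∑-pinch le ge i = sum-pinch (le i) (≤-reflexive (sym (sum-pinch (λ k → sum-mono (le k)) ge i)))

∑∑-scale-rows : ∀ {n} (f g : Matrix n) → (∀ i → sum (f i) ≡ sum (g i)) →
                (u : Fin n → ℕ) → ∑∑ (λ i j → f i j * u i) ≡ ∑∑ (λ i j → g i j * u i)
∑∑-scale-rows f g rows u = sum-cong-≗ λ i →
  trans (sym (*-distribʳ-sum (u i) (f i))) (trans (cong (_* u i) (rows i)) (*-distribʳ-sum (u i) (g i)))

-- A weight that is a row part plus a column part sees only the margins of a matrix.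
∑∑-scale : ∀ {n} (f g : Matrix n) →
           (∀ i → sum (f i) ≡ sum (g i)) → (∀ j → sum (flip f j) ≡ sum (flip g j)) →
           (u v : Fin n → ℕ) → ∑∑ (λ i j → f i j * (u i + v j)) ≡ ∑∑ (λ i j → g i j * (u i + v j))
∑∑-scale f g rows cols u v = trans (split f) (trans (cong₂ _+_ (∑∑-scale-rows f g rows u) columns) (sym (split g)))
  where
  split : ∀ h → ∑∑ (λ i j → h i j * (u i + v j)) ≡ ∑∑ (λ i j → h i j * u i) + ∑∑ (λ i j → h i j * v j)
  split h = trans (sum-cong-≗ (λ i → sum-cong-≗ (λ j → *-distribˡ-+ (h i j) (u i) (v j)))) (∑∑-distrib-+ (λ i j → h i j * u i) (λ i j → h i j * v j))
  columns : ∑∑ (λ i j → f i j * v j) ≡ ∑∑ (λ i j → g i j * v j)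
  columns = trans (∑-comm (λ i j → f i j * v j)) (trans (∑∑-scale-rows (flip f) (flip g) cols v) (∑-comm (λ j i → g i j * v j)))

indicator : ∀ {p} {P : Set p} → Dec P → ℕ
indicator (yes _) = 1
indicator (no _)  = 0

indicator-yes : ∀ {p} {P : Set p} (P? : Dec P) → P → indicator P? ≡ 1
indicator-yes (yes _) _ = refl
indicator-yes (no ¬p) p = contradiction p ¬p

indicator-no : ∀ {p} {P : Set p} (P? : Dec P) → ¬ P → indicator P? ≡ 0
indicator-no (yes p) ¬p = contradiction p ¬p
indicator-no (no _)  _  = refl

indicator-1 : ∀ {p} {P : Set p} (P? : Dec P) → indicator P? ≡ 1 → P
indicator-1 (yes p) _ = p

indicator-exclusive : ∀ {p q} {P : Set p} {Q : Set q} (P? : Dec P) (Q? : Dec Q) →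
                      (P → ¬ Q) → indicator P? + indicator Q? ≤ 1
indicator-exclusive (yes p) (yes q) ¬pq = contradiction q (¬pq p)
indicator-exclusive (yes _) (no _)  _   = s≤s z≤n
indicator-exclusive (no _)  (yes _) _   = s≤s z≤n
indicator-exclusive (no _)  (no _)  _   = z≤n

-- Comparing two stable matchings of the double cover.

module Comparison {n : ℕ} (rank : Fin n → Fin n → ℕ) (rank-inj : ∀ i → Injective _≡_ _≡_ (rank i)) where

  -- x i j counts the arcs i → j; the rows of a matrix are the out-sides of the
  -- agents in the bipartite double cover, the columns (rows of flip x) their in-sides.
  Rejects : Matrix n → Fin n → Fin n → Set
  Rejects x i j = ∀ k → 0 < x i k → rank i k ≤ rank i j

  Worsens : Matrix n → Matrix n → Fin n → Set
  Worsens x y i = ∃ λ j → x i j < y i j × Rejects x i j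

  rejects? : ∀ x i j → Dec (Rejects x i j)
  rejects? x i j = all? (λ k → (0 <? x i k) →-dec (rank i k ≤? rank i j))

  worsens? : ∀ x y i → Dec (Worsens x y i)
  worsens? x y i = any? (λ j → (x i j <? y i j) ×-dec rejects? x i j)

  -- The two witnesses bound each other's rank, so they coincide, and a single entry would both grow
  -- and shrink.
  worsens-asym : ∀ x y i → Worsens x y i → ¬ Worsens y x i
  worsens-asym x y i (j , x<y , rx) (k , y<x , ry)
    with rank-inj i (≤-antisym (rx k (≤-<-trans z≤n y<x)) (ry j (≤-<-trans z≤n x<y)))
  ... | refl = <-asym x<y y<x

  -- Equal degrees, together with stability in the double cover asked only where the entries differ.
  record Comparable (x y : Matrix n) : Set where
    field
      rows    : ∀ i → sum (x i) ≡ sum (y i)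
      columns : ∀ j → sum (flip x j) ≡ sum (flip y j)
      gained  : ∀ i j → x i j < y i j → Rejects x i j ⊎ Rejects (flip x) j i
      lost    : ∀ i j → y i j < x i j → Rejects y i j ⊎ Rejects (flip y) j i

  module _ {x y : Matrix n} (cmp : Comparable x y) where
    open Comparable cmp

    private
      d d′ : Matrix n
      d  i j = y i j ∸ x i j
      d′ i j = x i j ∸ y i j

      out out′ inn inn′ : Fin n → ℕ
      out  i = indicator (worsens? x y i)
      out′ i = indicator (worsens? y x i)
      inn  j = indicator (worsens? (flip x) (flip y) j)
      inn′ j = indicator (worsens? (flip y) (flip x) j)

      -- Each unit of difference is charged to an end that worsens. The pair `u`, `v` is generic
      -- because the bound serves gains and losses alike.
      covered : ∀ (u v : Matrix n) i j → (u i j < v i j → Rejects u i j ⊎ Rejects (flip u) j i) →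
                v i j ∸ u i j ≤ (v i j ∸ u i j) * (indicator (worsens? u v i) + indicator (worsens? (flip u) (flip v) j))
      covered u v i j rej with u i j <? v i j
      ... | no ≮ rewrite m≤n⇒m∸n≡0 (≮⇒≥ ≮) = z≤n
      ... | yes u<v = ≤-trans (≤-reflexive (sym (*-identityʳ (v i j ∸ u i j)))) (*-monoʳ-≤ (v i j ∸ u i j) (positive (rej u<v)))
        where
        positive : Rejects u i j ⊎ Rejects (flip u) j i → 1 ≤ indicator (worsens? u v i) + indicator (worsens? (flip u) (flip v) j)
        positive (inj₁ r) = subst (λ a → 1 ≤ a + indicator (worsens? (flip u) (flip v) j))
          (sym (indicator-yes (worsens? u v i) (j , u<v , r))) (s≤s z≤n)
        positive (inj₂ r) = subst (λ a → 1 ≤ indicator (worsens? u v i) + a)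
          (sym (indicator-yes (worsens? (flip u) (flip v) j) (i , u<v , r))) (m≤n+m 1 (indicator (worsens? u v i)))

      -- By `worsens-asym` an end worsens in at most one direction, so a lost arc carries at most
      -- two charges.
      exclusive : ∀ i j → d′ i j * (out i + inn j) + d′ i j * (out′ i + inn′ j) ≤ d′ i j + d′ i j
      exclusive i j = begin
        d′ i j * (out i + inn j) + d′ i j * (out′ i + inn′ j)   ≡⟨ regroup (d′ i j) (out i) (inn j) (out′ i) (inn′ j) ⟩
        d′ i j * ((out i + out′ i) + (inn j + inn′ j))          ≤⟨ *-monoʳ-≤ (d′ i j) (+-mono-≤
            (indicator-exclusive (worsens? x y i) (worsens? y x i) (worsens-asym x y i))
            (indicator-exclusive (worsens? (flip x) (flip y) j) (worsens? (flip y) (flip x) j) (worsens-asym (flip x) (flip y) j))) ⟩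
        d′ i j * 2                                              ≡⟨ double (d′ i j) ⟩
        d′ i j + d′ i j                                         ∎
        where
        open ≤-Reasoning
        regroup : ∀ m a b a′ b′ → m * (a + b) + m * (a′ + b′) ≡ m * ((a + a′) + (b + b′))
        regroup = solve-∀
        double : ∀ m → m * 2 ≡ m + m
        double = solve-∀

      N : ℕ
      N = ∑∑ d′

      rows-d : ∀ i → sum (d i) ≡ sum (d′ i)
      rows-d i = sum-∸ (x i) (y i) (rows i)

      columns-d : ∀ j → sum (flip d j) ≡ sum (flip d′ j)
      columns-d j = sum-∸ (flip x j) (flip y j) (columns j)

      D D′ : Matrix n
      D  i j = d′ i j * (out i + inn j)
      D′ i j = d′ i j * (out′ i + inn′ j)

      N≤D : N ≤ ∑∑ D
      N≤D = begin
        N                                          ≡⟨ sum-cong-≗ rows-d ⟨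
        ∑∑ d                                       ≤⟨ ∑∑-mono (λ i j → covered x y i j (gained i j)) ⟩
        -- Since `d` and `d′` have equal margins, the charges of the gained arcs can be counted on
        -- the lost arcs.
        ∑∑ (λ i j → d i j * (out i + inn j))       ≡⟨ ∑∑-scale d d′ rows-d columns-d out inn ⟩
        ∑∑ D                                       ∎
        where open ≤-Reasoning

      N≤D′ : N ≤ ∑∑ D′
      N≤D′ = ∑∑-mono (λ i j → covered y x i j (lost i j))

      D+D′≤2N : ∑∑ D + ∑∑ D′ ≤ N + N
      D+D′≤2N = subst₂ _≤_ (∑∑-distrib-+ D D′) (∑∑-distrib-+ d′ d′) (∑∑-mono exclusive)

      -- The totals satisfy `N ≤ D` and `D + D′ ≤ 2N`, hence `D′ ≤ N`, so the entrywise bound behind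
      -- `N≤D′` is tight everywhere.
      d′≡D′ : ∀ i j → d′ i j ≡ D′ i j
      d′≡D′ = ∑∑-pinch (λ i j → covered y x i j (lost i j))
        (+-cancelˡ-≤ N _ _ (≤-trans (+-monoˡ-≤ _ N≤D) D+D′≤2N))

      D+D′≡2d′ : ∀ i j → D i j + D′ i j ≡ d′ i j + d′ i j
      D+D′≡2d′ = ∑∑-pinch exclusive (subst₂ _≤_ (sym (∑∑-distrib-+ d′ d′)) (sym (∑∑-distrib-+ D D′)) (+-mono-≤ N≤D N≤D′))

      cancel : ∀ m k → 0 < m → m ≡ m * k → k ≡ 1
      cancel (suc m) k _ eq = *-cancelˡ-≡ k 1 (suc m) (trans (sym eq) (sym (*-identityʳ (suc m))))

      one-rejecting : ∀ {i j} → y i j < x i j → out′ i + inn′ j ≡ 1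
      one-rejecting {i} {j} y<x = cancel (d′ i j) _ (m<n⇒0<n∸m y<x) (d′≡D′ i j)

      -- Subtracting `d′≡D′` from the tight two-charge bound leaves exactly one charge in this
      -- direction too.
      one-worsening : ∀ {i j} → y i j < x i j → out i + inn j ≡ 1
      one-worsening {i} {j} y<x = cancel (d′ i j) _ (m<n⇒0<n∸m y<x)
        (sym (+-cancelʳ-≡ _ _ _ (trans (D+D′≡2d′ i j) (cong (d′ i j +_) (d′≡D′ i j)))))

      not-both : ∀ {i j} → y i j < x i j → Rejects y i j → ¬ Rejects (flip y) j i
      not-both {i} {j} y<x r r′ with trans (sym (one-rejecting y<x)) (cong₂ _+_
        (indicator-yes (worsens? y x i) (j , y<x , r))
        (indicator-yes (worsens? (flip y) (flip x) j) (i , y<x , r′)))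
      ... | ()

    -- Each of the N lost and N gained arcs has a rejecting end.  A row or column has as
    -- many lost as gained arcs and cannot reject arcs of both kinds, so there are at most
    -- 2N rejecting ends; hence each arc has exactly one.
    lost-arc : ∀ i j → y i j < x i j →
               (Rejects y i j × ¬ Rejects (flip y) j i × Worsens (flip x) (flip y) j) ⊎
               (Rejects (flip y) j i × ¬ Rejects y i j × Worsens x y i)
    lost-arc i j y<x with lost i j y<x
    ... | inj₁ r = inj₁ (r , not-both y<x r , indicator-1 _
      (subst (λ a → a + inn j ≡ 1) (indicator-no (worsens? x y i) (λ w → worsens-asym x y i w (j , y<x , r)))
        (one-worsening y<x)))
    ... | inj₂ r = inj₂ (r , flip (not-both y<x) r , indicator-1 _
      (trans (sym (+-identityʳ _)) (subst (λ a → out i + a ≡ 1)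
        (indicator-no (worsens? (flip x) (flip y) j) (λ w → worsens-asym (flip x) (flip y) j w (i , y<x , r)))
        (one-worsening y<x))))

≮0⇒≡0 : ∀ {m} → ¬ 0 < m → m ≡ 0
≮0⇒≡0 {zero}  _ = refl
≮0⇒≡0 {suc m} h = contradiction z<s h


-- Stable matrices and the arcs lost between them.

module HalfIntegral {n : ℕ} (I : SF n) where
  open SF I
  open Comparison rank rank-inj

  Linked : Matrix n → Fin n → Fin n → Set
  Linked x i k = 0 < x i k ⊎ 0 < x k i

  Saturated : Matrix n → Fin n → Fin n → Set
  Saturated x i j = ∀ k → Linked x i k → rank i k ≤ rank i j

  -- In the matrix of a generalised stable partition these are the arcs of the cycles of length at
  -- least 3.
  OneWay : Matrix n → Fin n → Fin n → Set
  OneWay x i j = 0 < x i j × x j i ≡ 0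

  -- A stable half-matching in doubled form: distinct i and j are matched with weight half of
  -- `x i j + x j i`. The diagonal counts unfilled places and may exceed 1.
  record Stable (x : Matrix n) : Set where
    field
      rows      : ∀ i → sum (x i) ≡ cap i
      columns   : ∀ j → sum (flip x j) ≡ cap j
      simple    : ∀ {i j} → i ≢ j → x i j ≤ 1
      unblocked : ∀ {i j} → i ≢ j → x i j ≡ 0 → Saturated x i j ⊎ Saturated x j i

  open Stable

  rank-self : ∀ i k → rank i k ≤ rank i i
  rank-self i k with k ≟ i
  ... | yes refl = ≤-refl
  ... | no k≢i   = <⇒≤ (selfLast i k k≢i)

  -- `Linked` is symmetric, so `unblocked` survives with its ends exchanged. This allows comparison
  -- with a transpose, in which cycles run backwards.
  flip-stable : ∀ {x} → Stable x → Stable (flip x)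
  flip-stable s .rows            = columns s
  flip-stable s .columns         = rows s
  flip-stable s .simple i≢j      = simple s (i≢j ∘ sym)
  flip-stable s .unblocked i≢j e =
    [ (λ sat → inj₂ λ k l → sat k (swap l)) , (λ sat → inj₁ λ k l → sat k (swap l)) ]′ (unblocked s (i≢j ∘ sym) e)

  below-simple : ∀ {x i j m} → Stable x → i ≢ j → m < x i j → m ≡ 0
  below-simple s i≢j lt = n<1⇒n≡0 (<-≤-trans lt (simple s i≢j))

  private
    -- On the diagonal the agent ranks itself last; elsewhere `simple` forces the smaller entry to
    -- be 0, and `unblocked` applies.
    ends-reject : ∀ {x y} → Stable x → Stable y → ∀ i j → y i j < x i j → Rejects y i j ⊎ Rejects (flip y) j i
    ends-reject {x} {y} sx sy i j lt with i ≟ j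
    ... | yes refl = inj₁ (λ k _ → rank-self i k)
    ... | no i≢j with unblocked sy i≢j (below-simple sx i≢j lt)
    ... | inj₁ sat = inj₁ (λ k p → sat k (inj₁ p))
    ... | inj₂ sat = inj₂ (λ k p → sat k (inj₂ p))

  comparable : ∀ {x y} → Stable x → Stable y → Comparable x y
  comparable sx sy = record
    { rows    = λ i → trans (rows sx i) (sym (rows sy i))
    ; columns = λ j → trans (columns sx j) (sym (columns sy j))
    ; gained  = ends-reject sy sx
    ; lost    = ends-reject sx sy
    }

  loops-agree : ∀ {x y i} → Stable x → Stable y → ¬ (y i i < x i i)
  loops-agree {i = i} sx sy lt with lost-arc (comparable sx sy) i i lt
  ... | inj₁ (_ , ¬r , _) = ¬r (λ k _ → rank-self i k)
  ... | inj₂ (_ , ¬r , _) = ¬r (λ k _ → rank-self i k)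

  lost⇒≢ : ∀ {x y i j} → Stable x → Stable y → y i j < x i j → i ≢ j
  lost⇒≢ sx sy lt refl = loops-agree sx sy lt

  -- `unblocked` gives a two-sided rejection at one of the ends; at j it would be a second rejecting
  -- end, which `lost-arc` excludes.
  rejects⇒saturated : ∀ {x y i j} → Stable x → Stable y → y i j < x i j → Rejects y i j → Saturated y i j
  rejects⇒saturated {x} {y} {i} {j} sx sy lt r
    with lost-arc (comparable sx sy) i j lt | unblocked sy (lost⇒≢ sx sy lt) (below-simple sx (lost⇒≢ sx sy lt) lt)
  ... | inj₂ (_ , ¬r , _) | _        = contradiction r ¬r
  ... | _                 | inj₁ sat = sat
  ... | inj₁ (_ , ¬r , _) | inj₂ sat = contradiction (λ k p → sat k (inj₂ p)) ¬r

  lost-link : ∀ {x y i j} → Stable x → Stable y → y i j < x i j →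
              (Saturated y i j × Worsens (flip x) (flip y) j) ⊎ (Rejects (flip y) j i × Worsens x y i)
  lost-link {i = i} {j} sx sy lt with lost-arc (comparable sx sy) i j lt
  ... | inj₁ (r , _ , w) = inj₁ (rejects⇒saturated sx sy lt r , w)
  ... | inj₂ (r , _ , w) = inj₂ (r , w)

  -- Passing from one arc of a cycle to the next.

  rank-≡ : ∀ {i j k} → rank i j ≤ rank i k → rank i k ≤ rank i j → j ≡ k
  rank-≡ {i} p q = rank-inj i (≤-antisym p q)

  -- If the arcs between j and h differed, j would have to gain an arc at least as bad as i. As i is
  -- worst for j in both matrices, that arc would be with i, where nothing is gained.
  next-common : ∀ {x y i j h} → Stable x → Stable y →
                OneWay x i j → OneWay y i j → Saturated x j i → Saturated y j i →
                OneWay x j h → rank j h < rank j i → OneWay y j h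
  next-common {x} {y} {i} {j} {h} sx sy (xij , xji) (yij , yji) satx saty (xjh , xhj) h<i = yjh , ≮0⇒≡0 ¬yhj
    where
    i≢j : i ≢ j
    i≢j refl = <⇒≢ xij (sym xji)
    yjh : 0 < y j h
    yjh with 0 <? y j h
    ... | yes p = p
    ... | no ≯0 with lost-link sx sy (subst (_< x j h) (sym (≮0⇒≡0 ≯0)) xjh)
    ... | inj₁ (sat , _) = contradiction (sat i (inj₂ yij)) (<⇒≱ h<i)
    ... | inj₂ (_ , k , lt , r)
      with rank-≡ (saty k (inj₁ (m<n⇒0<n lt))) (rejects⇒saturated sy sx lt r i (inj₂ xij))
    ... | refl = contradiction yji (>⇒≢ (m<n⇒0<n lt))
    ¬yhj : ¬ 0 < y h j
    ¬yhj p with lost-link sy sx (subst (_< y h j) (sym xhj) p)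
    ... | inj₂ (r , _) = <⇒≱ h<i (r i xij)
    ... | inj₁ (_ , k , lt , r) with rank-≡ (satx k (inj₂ (m<n⇒0<n lt))) (r i yij)
    ... | refl = contradiction (below-simple sx i≢j lt) (>⇒≢ yij)

  -- Used with p the predecessor of j on a cycle of the other stable matrix.
  Above Below : Matrix n → Fin n → Fin n → Set
  Above y p j = ∀ k → Linked y j k → rank j k < rank j p
  Below y p j = ∃ λ k → 0 < y j k × rank j p ≤ rank j k

  above-below : ∀ {y p j} → Above y p j → ¬ Below y p j
  above-below ab (k , p , le) = <⇒≱ (ab k (inj₁ p)) le

  saturated⇒above : ∀ {y j h} → Saturated y h j → ¬ Linked y h j → Above y j h
  saturated⇒above {y} sat ¬l k l = ≤∧≢⇒< (sat k l) (λ e → ¬l (subst (Linked y _) (rank-inj _ e) l))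

  -- Once j → h is known to be absent from `y`, one end rejects it. That end is not j, whose partner
  -- k is no better than i and so worse than h.
  below⇒above : ∀ {x y i j h} → Stable x → Stable y → (∀ {a b} → OneWay y a b → Saturated y b a) →
                0 < x i j → Saturated x j i → OneWay x j h → rank j h < rank j i →
                Below y i j → Above y j h
  below⇒above {x} {y} {i} {j} {h} sx sy worst xij satx (xjh , xhj) h<i (k , yjk , i≤k) =
    [ (λ sat → contradiction sat ¬sat) , (λ sat → saturated⇒above {y} sat ¬linked) ]′ (unblocked sy j≢h yjh)
    where
    j≢h : j ≢ h
    j≢h refl = <⇒≢ xjh (sym xhj)
    ¬sat : ¬ Saturated y j h
    ¬sat sat = <⇒≱ h<i (≤-trans i≤k (sat k (inj₁ yjk)))
    ¬yjh : ¬ 0 < y j h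
    -- Otherwise j → h is lost on passing from `y` to the transpose of `x`, where j still has i. So
    -- j gains an arc no better than k; as i is worst for j in `x`, that arc and k are both i, but
    -- `y j i` is already positive.
    ¬yjh p with lost-link sy (flip-stable sx) (subst (_< y j h) (sym xhj) p)
    ... | inj₁ (sat , _) = <⇒≱ h<i (sat i (inj₁ xij))
    ... | inj₂ (_ , g , lt , r)
      with rank-≡ (satx g (inj₂ (m<n⇒0<n lt))) (≤-trans i≤k (r k yjk))
    ... | refl with rank-≡ (r k yjk) i≤k
    ... | refl = <⇒≢ yjk (sym (below-simple (flip-stable sx) (lost⇒≢ (flip-stable sx) sy lt) lt))
    yjh : y j h ≡ 0
    yjh = ≮0⇒≡0 ¬yjh
    ¬linked : ¬ Linked y h j
    ¬linked (inj₁ yhj) = ¬sat (worst (yhj , yjh))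
    ¬linked (inj₂ p)   = ¬yjh p

  -- If `y` has no arc between h and g, then h → g is lost from `x`, and its reverse from the
  -- transpose of `x`. The first loss cannot make h worse off, since its partners stay better than
  -- j, so h rejects g; then the second loss gives g the required bad successor.
  above⇒below : ∀ {x y j h g} → Stable x → Stable y →
                0 < x j h → OneWay x h g → ¬ OneWay y h g →
                Above y j h → Below y h g
  above⇒below {x} {y} {j} {h} {g} sx sy xjh (xhg , _) ¬one ab with 0 <? y g h
  ... | yes ygh = h , ygh , ≤-refl
  ... | no ¬ygh with lost-link sx sy (subst (_< x h g) (sym (≮0⇒≡0 λ yhg → ¬one (yhg , ≮0⇒≡0 ¬ygh))) xhg)
  ... | inj₂ (_ , k , lt , r) =
    contradiction (rejects⇒saturated sy sx lt r j (inj₂ xjh)) (<⇒≱ (ab k (inj₁ (m<n⇒0<n lt))))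
  ... | inj₁ (sat , _) with lost-link (flip-stable sx) sy (subst (_< x h g) (sym (≮0⇒≡0 ¬ygh)) xhg)
  ... | inj₂ (_ , k , lt , r) = k , m<n⇒0<n lt , r h xhg
  ... | inj₁ (_ , k , lt , r) with rank-≡ (r g xhg) (sat k (inj₂ (m<n⇒0<n lt)))
  ... | refl = contradiction (m<n⇒0<n lt) ¬ygh

  -- Supplies the starting state of the alternation. If `y` has no arc between i and j, one of them
  -- rejects the other.
  above-or-below : ∀ {y p i j} → Stable y → i ≢ j → rank i j < rank i p → ¬ OneWay y i j →
                   Above y p i ⊎ Above y i j ⊎ Below y i j
  above-or-below {y} {p} {i} {j} sy i≢j j<p ¬one with 0 <? y j i
  ... | yes yji = inj₂ (inj₂ (i , yji , ≤-refl))
  ... | no ¬yji with 0 <? y i j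
  ... | yes yij = contradiction (yij , ≮0⇒≡0 ¬yji) ¬one
  ... | no ¬yij with unblocked sy i≢j (≮0⇒≡0 ¬yij)
  ... | inj₁ sat = inj₁ (λ k l → ≤-<-trans (sat k l) j<p)
  ... | inj₂ sat = inj₂ (inj₁ (saturated⇒above {y} sat [ ¬yji , ¬yij ]′))

-- Cycles as lists

data Walk {A : Set} (f : A → Maybe A) : ℕ → A → A → Set where
  stop : ∀ {x} → Walk f 0 x x
  step : ∀ {k x y z} → f x ≡ just y → Walk f k y z → Walk f (suc k) x z

module _ {A : Set} {f : A → Maybe A} where

  walk-++ : ∀ {k l x y z} → Walk f k x y → Walk f l y z → Walk f (k + l) x z
  walk-++ stop       w′ = w′
  walk-++ (step e w) w′ = step e (walk-++ w w′)

  walk-deterministic : ∀ {k x y z} → Walk f k x y → Walk f k x z → y ≡ z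
  walk-deterministic stop       stop         = refl
  walk-deterministic (step e w) (step e′ w′) with trans (sym e) e′
  ... | refl = walk-deterministic w w′

  walk-forward : (P : A → Set) → (∀ {u v} → f u ≡ just v → P u → P v) →
                 ∀ {k x y} → Walk f k x y → P x → P y
  walk-forward P next stop       px = px
  walk-forward P next (step e w) px = walk-forward P next w (next e px)

  walk-backward : (P : A → Set) → (∀ {u v} → f u ≡ just v → P v → P u) →
                  ∀ {k x y} → Walk f k x y → P y → P x
  walk-backward P prev stop       py = py
  walk-backward P prev (step e w) py = prev e (walk-backward P prev w py)

  -- Two steps are taken at a time, as `suc (suc k) % 2` reduces to `k % 2`.
  walk-alternate : (P Q : A → Set) →
                   (∀ {u v} → f u ≡ just v → P u → Q v) → (∀ {u v} → f u ≡ just v → Q u → P v) →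
                   ∀ {k x y} → Walk f k x y → k % 2 ≡ 1 → P x → Q y
  walk-alternate P Q pq qp (step e stop)          _   px = pq e px
  walk-alternate P Q pq qp (step e (step e′ w)) odd px = walk-alternate P Q pq qp w odd (qp e′ (pq e px))

  last-step : ∀ {k x z} → Walk f (suc k) x z → ∃ λ y → f y ≡ just z
  last-step (step e stop)          = _ , e
  last-step (step _ (step e w)) = last-step (step e w)

-- The return target `z` is kept apart from the first entry, so that a tail of a cycle is again a
-- chain.
data Chain {A : Set} (f : A → Maybe A) (z : A) : List A → Set where
  [_]ᶜ : ∀ {a} → f a ≡ just z → Chain f z (a ∷ [])
  _∷ᶜ_ : ∀ {a b bs} → f a ≡ just b → Chain f z (b ∷ bs) → Chain f z (a ∷ b ∷ bs)

chain-cong : ∀ {A : Set} {f g : A → Maybe A} {z l} → (∀ {a} → a ∈ l → f a ≡ g a) → Chain f z l → Chain g z l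
chain-cong eq [ e ]ᶜ   = [ trans (sym (eq (here refl))) e ]ᶜ
chain-cong eq (e ∷ᶜ c) = trans (sym (eq (here refl))) e ∷ᶜ chain-cong (eq ∘ there) c

chain⇒walks : ∀ {A : Set} {f : A → Maybe A} {z a as x} → Chain f z (a ∷ as) → x ∈ a ∷ as →
              ∃ λ k → ∃ λ l → k + l ≡ length (a ∷ as) × Walk f k a x × Walk f l x z
chain⇒walks c (here refl) = 0 , _ , refl , stop , whole c
  where
  whole : ∀ {a as} → Chain _ _ (a ∷ as) → Walk _ (length (a ∷ as)) a _
  whole [ e ]ᶜ   = step e stop
  whole (e ∷ᶜ c) = step e (whole c)
chain⇒walks (e ∷ᶜ c) (there x∈) with chain⇒walks c x∈
... | k , l , eq , w , w′ = suc k , l , cong suc eq , step e w , w′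

module _ {n : ℕ} where

  cyc-head : ∀ (h : Fin n) b bs → cyc (h ∷ b ∷ bs) h ≡ just b
  cyc-head h b bs with h ≟ h
  ... | yes _  = refl
  ... | no h≢h = contradiction refl h≢h

  cyc-singleton : ∀ (h : Fin n) → cyc (h ∷ []) h ≡ just h
  cyc-singleton h with h ≟ h
  ... | yes _  = refl
  ... | no h≢h = contradiction refl h≢h

  cyc-second : ∀ {h b : Fin n} → h ≢ b → ∀ c cs → cyc (h ∷ b ∷ c ∷ cs) b ≡ just c
  cyc-second {h} {b} h≢b c cs with h ≟ b | b ≟ b
  ... | yes h≡b | _      = contradiction h≡b h≢b
  ... | no _    | yes _  = refl
  ... | no _    | no b≢b = contradiction refl b≢b

  cyc-second-last : ∀ {h b : Fin n} → h ≢ b → cyc (h ∷ b ∷ []) b ≡ just h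
  cyc-second-last {h} {b} h≢b with h ≟ b | b ≟ b
  ... | yes h≡b | _      = contradiction h≡b h≢b
  ... | no _    | yes _  = refl
  ... | no _    | no b≢b = contradiction refl b≢b

  cyc-skip : ∀ {h b x : Fin n} → h ≢ x → b ≢ x → ∀ cs → cyc (h ∷ b ∷ cs) x ≡ cyc (h ∷ cs) x
  cyc-skip {h} {b} {x} h≢x b≢x [] with h ≟ x | b ≟ x
  ... | yes h≡x | _       = contradiction h≡x h≢x
  ... | no _    | yes b≡x = contradiction b≡x b≢x
  ... | no _    | no _    = refl
  cyc-skip {h} {b} {x} h≢x b≢x (c ∷ cs) with h ≟ x | b ≟ x
  ... | yes h≡x | _       = contradiction h≡x h≢x
  ... | no _    | yes b≡x = contradiction b≡x b≢x
  ... | no _    | no _    = refl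

  cyc-∉ : ∀ (c : List (Fin n)) {x} → x ∉ c → cyc c x ≡ nothing
  cyc-∉ [] _ = refl
  cyc-∉ (h ∷ []) {x} x∉ with h ≟ x
  ... | yes refl = contradiction (here refl) x∉
  ... | no _     = refl
  cyc-∉ (h ∷ b ∷ cs) x∉ =
    trans (cyc-skip (λ { refl → x∉ (here refl) }) (λ { refl → x∉ (there (here refl)) }) cs)
          (cyc-∉ (h ∷ cs) λ { (here e) → x∉ (here e) ; (there p) → x∉ (there (there p)) })

  -- The induction deletes the second entry, since `cyc` closes up at the head: away from h and b,
  -- deleting b does not change the map.
  cyc-chain : ∀ {h : Fin n} {t} → Unique (h ∷ t) → Chain (cyc (h ∷ t)) h (h ∷ t)
  cyc-chain {h} {[]} _ = [ cyc-singleton h ]ᶜ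
  cyc-chain {h} {b ∷ []} ((h≢b ∷ _) ∷ _) = cyc-head h b [] ∷ᶜ [ cyc-second-last h≢b ]ᶜ
  cyc-chain {h} {b ∷ c ∷ cs} ((h≢b ∷ h≢) ∷ b≢ ∷ u) with cyc-chain (h≢ ∷ u)
  ... | _ ∷ᶜ ch = cyc-head h b (c ∷ cs) ∷ᶜ (cyc-second h≢b c cs ∷ᶜ
          chain-cong (λ a∈ → sym (cyc-skip (All.lookup h≢ a∈) (All.lookup b≢ a∈) (c ∷ cs))) ch)

  cyc⇒∈ : ∀ (c : List (Fin n)) {x y} → cyc c x ≡ just y → x ∈ c
  cyc⇒∈ c {x} e with _∈?_ _≟_ x c
  ... | yes x∈ = x∈
  ... | no x∉  with trans (sym e) (cyc-∉ c x∉)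
  ... | ()

  connected : ∀ {c : List (Fin n)} → WFCycle c → ∀ {x y} → x ∈ c → y ∈ c → ∃ λ k → Walk (cyc c) k x y
  connected (u , h , t , refl) x∈ y∈ with chain⇒walks (cyc-chain u) x∈ | chain⇒walks (cyc-chain u) y∈
  ... | _ , _ , _ , _ , w | _ , _ , _ , w′ , _ = _ , walk-++ w w′

  round-trip : ∀ {c : List (Fin n)} → WFCycle c → ∀ {x} → x ∈ c → Walk (cyc c) (length c) x x
  round-trip (u , h , t , refl) {x} x∈ with chain⇒walks (cyc-chain u) x∈
  ... | k , l , eq , w , w′ =
    subst (λ m → Walk (cyc (h ∷ t)) m x x) (trans (+-comm l k) eq) (walk-++ w′ w)

  -- The length appears as a successor, so every round trip can be split at its first step, and one
  -- `k` serves all entries.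
  nontrivial-round-trip : ∀ {c : List (Fin n)} → WFCycle c → ∃ λ k → ∀ {x} → x ∈ c → Walk (cyc c) (suc k) x x
  nontrivial-round-trip wf@(_ , _ , t , refl) = length t , round-trip wf

  module _ {c : List (Fin n)} (wf : WFCycle c) where

    successor : ∀ {x} → x ∈ c → ∃ λ y → cyc c x ≡ just y
    successor x∈ with proj₂ (nontrivial-round-trip wf) x∈
    ... | step e _ = _ , e

    predecessor : ∀ {y} → y ∈ c → ∃ λ x → cyc c x ≡ just y
    predecessor y∈ = last-step (proj₂ (nontrivial-round-trip wf) y∈)

    target∈ : ∀ {x y} → cyc c x ≡ just y → y ∈ c
    target∈ {x} e with nontrivial-round-trip wf
    ... | _ , trip with trip (cyc⇒∈ c e)
    ... | step e′ w with trans (sym e) e′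
    ... | refl with w
    ... | stop      = cyc⇒∈ c e
    ... | step e″ _ = cyc⇒∈ c e″

    -- Both preimages are reached from y by walks of the same length, one step short of a round
    -- trip.
    cyc-injective : ∀ {x x′ y} → cyc c x ≡ just y → cyc c x′ ≡ just y → x ≡ x′
    cyc-injective {x} {x′} {y} e e′ = walk-deterministic (from e) (from e′)
      where
      from : ∀ {u} → cyc c u ≡ just y → Walk (cyc c) (proj₁ (nontrivial-round-trip wf)) y u
      from eu with proj₂ (nontrivial-round-trip wf) (cyc⇒∈ c eu)
      ... | step e″ w with trans (sym eu) e″
      ... | refl = w

    fixed⇒all : ∀ {x y} → cyc c x ≡ just x → y ∈ c → y ≡ x
    fixed⇒all {x} e y∈ = walk-forward (_≡ x)
      (λ { e′ refl → Maybe.just-injective (trans (sym e′) e) }) (proj₂ (connected wf (cyc⇒∈ c e) y∈)) refl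

    swapped⇒all : ∀ {x y z} → cyc c x ≡ just y → cyc c y ≡ just x → z ∈ c → z ≡ x ⊎ z ≡ y
    swapped⇒all {x} {y} e e′ z∈ = walk-forward (λ z → z ≡ x ⊎ z ≡ y)
      (λ { e″ (inj₁ refl) → inj₂ (Maybe.just-injective (trans (sym e″) e))
         ; e″ (inj₂ refl) → inj₁ (Maybe.just-injective (trans (sym e″) e′)) })
      (proj₂ (connected wf (cyc⇒∈ c e) z∈)) (inj₁ refl)

    long⇒all-long : ∀ {i j u v} → i ≢ j → cyc c i ≡ just j → cyc c j ≢ just i →
                    cyc c u ≡ just v → u ≢ v × cyc c v ≢ just u
    long⇒all-long {i} {j} i≢j ij ¬ji uv = (λ { refl → i≢j (trans (fixed⇒all uv i∈) (sym (fixed⇒all uv j∈))) }) , ¬vu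
      where
      i∈ = cyc⇒∈ c ij
      j∈ = target∈ ij
      ¬vu : cyc c _ ≢ just _
      ¬vu vu with swapped⇒all uv vu i∈ | swapped⇒all uv vu j∈
      ... | inj₁ refl | inj₁ refl = i≢j refl
      ... | inj₁ refl | inj₂ refl = ¬ji vu
      ... | inj₂ refl | inj₁ refl = ¬ji uv
      ... | inj₂ refl | inj₂ refl = i≢j refl

    -- Alternating between x and y, an odd round trip from x would end at y.
    odd⇒¬swapped : length c % 2 ≡ 1 → ∀ {x y} → x ≢ y → cyc c x ≡ just y → cyc c y ≢ just x
    odd⇒¬swapped odd {x} {y} x≢y xy yx = x≢y (walk-alternate (_≡ x) (_≡ y)
      (λ { e refl → Maybe.just-injective (trans (sym e) xy) })
      (λ { e refl → Maybe.just-injective (trans (sym e) yx) })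
      (round-trip wf (cyc⇒∈ c xy)) odd refl)

  -- Agreement spreads backwards along the cycle. The hypothesis concerns predecessors because
  -- stability determines those, as worst partners.
  agree-on : ∀ {c c′ : List (Fin n)} → WFCycle c → WFCycle c′ →
             ∀ {a b} → cyc c a ≡ just b → cyc c′ a ≡ just b →
             (∀ {u u′ v} → cyc c u ≡ just v → cyc c′ u′ ≡ just v → u ≡ u′) →
             ∀ {x} → x ∈ c → ∃ λ y → cyc c x ≡ just y × cyc c′ x ≡ just y
  agree-on {c} {c′} wf wf′ ab ab′ uniq x∈ = walk-backward
    (λ u → ∃ λ v → cyc c u ≡ just v × cyc c′ u ≡ just v) back
    (proj₂ (connected wf x∈ (cyc⇒∈ c ab))) (_ , ab , ab′)
    where
    back : ∀ {u v} → cyc c u ≡ just v → (∃ λ w → cyc c v ≡ just w × cyc c′ v ≡ just w) →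
           ∃ λ w → cyc c u ≡ just w × cyc c′ u ≡ just w
    back uv (_ , _ , vw′) with predecessor wf′ (cyc⇒∈ c′ vw′)
    ... | _ , uv′ with uniq uv uv′
    ... | refl = _ , uv , uv′

  same-cycle : ∀ {c c′ : List (Fin n)} → WFCycle c → WFCycle c′ →
               ∀ {a b} → cyc c a ≡ just b → cyc c′ a ≡ just b →
               (∀ {u u′ v} → cyc c u ≡ just v → cyc c′ u′ ≡ just v → u ≡ u′) → SameCycle c c′
  same-cycle {c} {c′} wf wf′ ab ab′ uniq x with _∈?_ _≟_ x c | _∈?_ _≟_ x c′
  ... | no x∉  | no x∉′ = trans (cyc-∉ c x∉) (sym (cyc-∉ c′ x∉′))
  ... | yes x∈ | _      with agree-on wf wf′ ab ab′ uniq x∈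
  ... | _ , e , e′ = trans e (sym e′)
  same-cycle {c} {c′} wf wf′ ab ab′ uniq x | no _ | yes x∈
    with agree-on wf′ wf ab′ ab (λ e′ e → sym (uniq e e′)) x∈
  ... | _ , e , e′ = trans e′ (sym e)

-- Stable matrices from generalised stable partitions

sum-zero : ∀ {n} {f : Fin n → ℕ} → (∀ i → f i ≡ 0) → sum f ≡ 0
sum-zero {zero}  _ = refl
sum-zero {suc n} z = cong₂ _+_ (z zero) (sum-zero (z ∘ suc))

sum-indicator-≡1 : ∀ {n} {P : Fin n → Set} (P? : ∀ i → Dec (P i)) {v} → P v → (∀ {i} → P i → i ≡ v) →
                   sum (λ i → indicator (P? i)) ≡ 1
sum-indicator-≡1 {suc n} P? {zero} pv uniq =
  cong₂ _+_ (indicator-yes (P? zero) pv)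
            (sum-zero (λ i → indicator-no (P? (suc i)) (λ p → contradiction (uniq p) λ ())))
sum-indicator-≡1 {suc n} P? {suc v} pv uniq =
  cong₂ _+_ (indicator-no (P? zero) (λ p → contradiction (uniq p) λ ()))
            (sum-indicator-≡1 (P? ∘ suc) pv (Fin-suc-injective ∘ uniq))

module _ {A : Set} {P : A → Set} (P? : Decidable P) where

  count : List A → ℕ
  count xs = length (filter P? xs)

  count-∷ : ∀ x xs → count (x ∷ xs) ≡ indicator (P? x) + count xs
  count-∷ x xs with P? x
  ... | yes _ = refl
  ... | no _  = refl

  count>0 : ∀ xs → 0 < count xs → ∃ λ r → P (lookup xs r)
  count>0 (x ∷ xs) lt with P? x
  ... | yes px = zero , px
  ... | no _ with count>0 xs lt
  ... | r , pr = suc r , pr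

  lookup⇒count>0 : ∀ xs r → P (lookup xs r) → 0 < count xs
  lookup⇒count>0 (x ∷ xs) r p with P? x
  ... | yes _ = z<s
  lookup⇒count>0 (x ∷ xs) zero    p | no ¬p = contradiction p ¬p
  lookup⇒count>0 (x ∷ xs) (suc r) p | no _  = lookup⇒count>0 xs r p

  count>1 : ∀ xs → 1 < count xs → ∃ λ r → ∃ λ s → r ≢ s × P (lookup xs r) × P (lookup xs s)
  count>1 (x ∷ xs) lt with P? x
  ... | yes px with count>0 xs (s<s⁻¹ lt)
  ... | s , ps = zero , suc s , (λ ()) , px , ps
  count>1 (x ∷ xs) lt | no _ with count>1 xs lt
  ... | r , s , r≢s , pr , ps = suc r , suc s , (λ { refl → r≢s refl }) , pr , ps

  lookup⇒count>1 : ∀ xs r s → r ≢ s → P (lookup xs r) → P (lookup xs s) → 1 < count xs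
  lookup⇒count>1 (x ∷ xs) r s r≢s pr ps with P? x
  lookup⇒count>1 (x ∷ xs) zero    zero    r≢s pr ps | _ = contradiction refl r≢s
  lookup⇒count>1 (x ∷ xs) zero    s       r≢s pr ps | no ¬p = contradiction pr ¬p
  lookup⇒count>1 (x ∷ xs) r       zero    r≢s pr ps | no ¬p = contradiction ps ¬p
  lookup⇒count>1 (x ∷ xs) zero    (suc s) r≢s pr ps | yes _ = s<s (lookup⇒count>0 xs s ps)
  lookup⇒count>1 (x ∷ xs) (suc r) s       r≢s pr ps | yes _ = s<s (lookup⇒count>0 xs r pr)
  lookup⇒count>1 (x ∷ xs) (suc r) (suc s) r≢s pr ps | no _  = lookup⇒count>1 xs r s (λ { refl → r≢s refl }) pr ps

module _ {n : ℕ} where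

  maps? : ∀ (i j : Fin n) → Decidable (λ c → cyc c i ≡ just j)
  maps? i j c = Maybe.≡-dec _≟_ (cyc c i) (just j)

  private
    sum-count : ∀ {i : Fin n} {P : Fin n → List (Fin n) → Set} (P? : ∀ j → Decidable (P j)) Π →
                All (λ c → sum (λ j → indicator (P? j c)) ≡ indicator (_∈?_ _≟_ i c)) Π →
                sum (λ j → count (P? j) Π) ≡ countIn Π i
    sum-count {i} P? [] [] = sum-zero {n} (λ _ → refl)
    sum-count {i} P? (c ∷ Π) (e ∷ es) = begin
      sum (λ j → count (P? j) (c ∷ Π))                                  ≡⟨ sum-cong-≗ (λ j → count-∷ (P? j) c Π) ⟩
      sum (λ j → indicator (P? j c) + count (P? j) Π)                   ≡⟨ ∑-distrib-+ (λ j → indicator (P? j c)) (λ j → count (P? j) Π) ⟩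
      sum (λ j → indicator (P? j c)) + sum (λ j → count (P? j) Π)       ≡⟨ cong₂ _+_ e (sum-count P? Π es) ⟩
      indicator (_∈?_ _≟_ i c) + countIn Π i                            ≡⟨ count-∷ (_∈?_ _≟_ i) c Π ⟨
      countIn (c ∷ Π) i                                                 ∎
      where open ≡-Reasoning

  sum-countMaps-row : ∀ {Π} → All WFCycle Π → ∀ (i : Fin n) → sum (countMaps Π i) ≡ countIn Π i
  sum-countMaps-row {Π} wfs i = sum-count (maps? i) Π (All.map one wfs)
    where
    one : ∀ {c} → WFCycle c → sum (λ j → indicator (maps? i j c)) ≡ indicator (_∈?_ _≟_ i c)
    one {c} wf with _∈?_ _≟_ i c
    ... | no i∉ = sum-zero (λ j → indicator-no (maps? i j c) (i∉ ∘ cyc⇒∈ c))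
    ... | yes i∈ with successor wf i∈
    ... | v , e = sum-indicator-≡1 (λ j → maps? i j c) e (λ e′ → Maybe.just-injective (trans (sym e′) e))

  sum-countMaps-column : ∀ {Π} → All WFCycle Π → ∀ (j : Fin n) → sum (flip (countMaps Π) j) ≡ countIn Π j
  sum-countMaps-column {Π} wfs j = sum-count (flip maps? j) Π (All.map one wfs)
    where
    one : ∀ {c} → WFCycle c → sum (λ i → indicator (maps? i j c)) ≡ indicator (_∈?_ _≟_ j c)
    one {c} wf with _∈?_ _≟_ j c
    ... | no j∉ = sum-zero (λ i → indicator-no (maps? i j c) (j∉ ∘ target∈ wf))
    ... | yes j∈ with predecessor wf j∈
    ... | v , e = sum-indicator-≡1 (λ i → maps? i j c) e (λ e′ → cyc-injective wf e′ e)

module Arcs {n : ℕ} {I : SF n} {Π : List (List (Fin n))} (gsp : GSP I Π) where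
  open SF I
  open HalfIntegral I
  open GSP gsp

  Arc : Fin (length Π) → Fin n → Fin n → Set
  Arc r i j = cyc (lookup Π r) i ≡ just j

  x : Matrix n
  x = countMaps Π

  wf-lookup : ∀ r → WFCycle (lookup Π r)
  wf-lookup r = All.lookup wf (∈-lookup r)

  arc⇒x>0 : ∀ {r i j} → Arc r i j → 0 < x i j
  arc⇒x>0 {r} {i} {j} = lookup⇒count>0 (maps? i j) Π r

  x>0⇒arc : ∀ {i j} → 0 < x i j → ∃ λ r → Arc r i j
  x>0⇒arc {i} {j} = count>0 (maps? i j) Π

  swap∈Π⇒arcs : ∀ {i j} → i ≢ j → (i ∷ j ∷ []) ∈Π Π → ∃ λ r → Arc r i j × Arc r j i
  swap∈Π⇒arcs {i} {j} i≢j (r , same) =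
    r , trans (sym (same i)) (cyc-head i j []) , trans (sym (same j)) (cyc-second-last i≢j)

  no-third : ∀ {i j} → i ≢ j → 1 < x i j → ¬ 0 < x j i
  no-third i≢j p q = <⇒≱ (+-mono-≤ p q) (F4 _ _ i≢j)

  -- The transposition would bring a second arc i → j and an arc j → i, three in all, against (F4).
  lone-arc : ∀ {r i j} → i ≢ j → Arc r i j → ¬ Arc r j i → ¬ ((i ∷ j ∷ []) ∈Π Π)
  lone-arc {r} {i} {j} i≢j ij ¬ji m with swap∈Π⇒arcs i≢j m
  ... | t , ij′ , ji′ = no-third i≢j
    (lookup⇒count>1 (maps? i j) Π r t (λ { refl → ¬ji ji′ }) ij ij′) (arc⇒x>0 ji′)

  -- (F2) speaks of predecessors only; by (F1) a bound on the predecessors bounds all partners.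
  behind : ∀ {i k} → Linked x i k → ∃ λ m → 0 < x m i × rank i k ≤ rank i m
  behind (inj₂ p) = _ , p , ≤-refl
  behind {i} {k} (inj₁ p) with x>0⇒arc p
  ... | r , ik with predecessor (wf-lookup r) (cyc⇒∈ (lookup Π r) ik)
  ... | m , mi = m , arc⇒x>0 mi , F1 r i k m ik mi

  wouldPrefer : ∀ {i j m} → 0 < x m i → rank i j < rank i m → WouldPrefer I Π i j
  wouldPrefer p lt with x>0⇒arc p
  ... | r , mi = r , _ , mi , lt

  ¬wouldPrefer⇒saturated : ∀ {i j} → ¬ WouldPrefer I Π i j → Saturated x i j
  ¬wouldPrefer⇒saturated ¬wp k l with behind l
  ... | m , p , k≤m = ≤-trans k≤m (≮⇒≥ (¬wp ∘ wouldPrefer p))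

  not-swap⇒saturated : ∀ {i j} → i ≢ j → ¬ ((i ∷ j ∷ []) ∈Π Π) → Saturated x i j ⊎ Saturated x j i
  not-swap⇒saturated {i} {j} i≢j ¬m with any? (λ m → (0 <? x m i) ×-dec (rank i j <? rank i m))
  ... | yes (m , p , lt) = inj₂ (¬wouldPrefer⇒saturated (λ wp → F2 i j i≢j ¬m (wouldPrefer p lt , wp)))
  ... | no ¬p = inj₁ (¬wouldPrefer⇒saturated (λ { (r , z , zi , lt) → ¬p (z , arc⇒x>0 zi , lt) }))

  arc-improves : ∀ {r p i j} → Arc r p i → Arc r i j → p ≢ j → rank i j < rank i p
  arc-improves {r} {p} {i} {j} pi ij p≢j = ≤∧≢⇒< (F1 r i j p ij pi) (p≢j ∘ sym ∘ rank-inj i)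

  -- Agent i prefers its successor j to its predecessor, so by (F2) j has nobody worse than i.
  lone-arc-worst : ∀ {r i j} → i ≢ j → Arc r i j → ¬ Arc r j i → Saturated x j i
  lone-arc-worst {r} {i} {j} i≢j ij ¬ji with predecessor (wf-lookup r) (cyc⇒∈ (lookup Π r) ij)
  ... | p , pi = ¬wouldPrefer⇒saturated λ wp → F2 i j i≢j (lone-arc i≢j ij ¬ji)
    ((r , p , pi , arc-improves pi ij (λ { refl → ¬ji pi })) , wp)

  -- By (F4), an arc j → i elsewhere would again lie on a cycle without its reverse. Then j would be
  -- worst for i, yet the predecessor of i on cycle `r` is strictly worse.
  lone-arc-oneWay : ∀ {r i j} → i ≢ j → Arc r i j → ¬ Arc r j i → OneWay x i j
  lone-arc-oneWay {r} {i} {j} i≢j ij ¬ji = arc⇒x>0 ij , ≮0⇒≡0 ¬x>0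
    where
    ¬x>0 : ¬ 0 < x j i
    ¬x>0 lt with x>0⇒arc lt
    ... | s , ji with predecessor (wf-lookup r) (cyc⇒∈ (lookup Π r) ij)
    ... | p , pi = <⇒≱ (arc-improves pi ij (λ { refl → ¬ji pi }))
      (lone-arc-worst (i≢j ∘ sym) ji
        (λ ij′ → no-third i≢j (lookup⇒count>1 (maps? i j) Π r s (λ { refl → ¬ji ji }) ij ij′) lt)
        p (inj₂ (arc⇒x>0 pi)))

  oneWay⇒arc : ∀ {i j} → OneWay x i j → i ≢ j × ∃ λ r → Arc r i j × ¬ Arc r j i
  oneWay⇒arc (p , z) with x>0⇒arc p
  ... | r , ij = (λ { refl → <⇒≢ p (sym z) }) , r , ij , λ ji → <⇒≢ (arc⇒x>0 ji) (sym z)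

  oneWay-worst : ∀ {i j} → OneWay x i j → Saturated x j i
  oneWay-worst o with oneWay⇒arc o
  ... | i≢j , r , ij , ¬ji = lone-arc-worst i≢j ij ¬ji

  long-worst : ∀ {r i j u v} → i ≢ j → Arc r i j → ¬ Arc r j i → Arc r u v → Saturated x v u
  long-worst {r} i≢j ij ¬ji uv with long⇒all-long (wf-lookup r) i≢j ij ¬ji uv
  ... | u≢v , ¬vu = lone-arc-worst u≢v uv ¬vu

  -- By (F4) two arcs i → j exclude j → i, so both their cycles have length at least 3. Predecessors
  -- there are worst partners, so the two cycles coincide, which `distinct` allows only for fixed
  -- points.
  simple : ∀ {i j} → i ≢ j → x i j ≤ 1
  simple {i} {j} i≢j = ≮⇒≥ twice
    where
    twice : ¬ 1 < x i j
    twice lt with count>1 (maps? i j) Π lt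
    ... | r , s , r≢s , ij , ij′ =
      i≢j (singleton (lookup Π r) (distinct r s r≢s same) (cyc⇒∈ (lookup Π r) ij) (target∈ (wf-lookup r) ij))
      where
      ¬ji : ∀ {t} → ¬ Arc t j i
      ¬ji ji = no-third i≢j lt (arc⇒x>0 ji)
      same : SameCycle (lookup Π r) (lookup Π s)
      same = same-cycle (wf-lookup r) (wf-lookup s) ij ij′ λ uv uv′ → rank-≡
        (long-worst i≢j ij′ ¬ji uv′ _ (inj₂ (arc⇒x>0 uv)))
        (long-worst i≢j ij ¬ji uv _ (inj₂ (arc⇒x>0 uv′)))
      singleton : ∀ (c : List (Fin n)) → length c ≡ 1 → ∀ {a b} → a ∈ c → b ∈ c → a ≡ b
      singleton (_ ∷ []) _ (here refl) (here refl) = refl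

  stable : Stable x
  stable = record
    { rows      = λ i → trans (sum-countMaps-row wf i) (F3 i)
    ; columns   = λ j → trans (sum-countMaps-column wf j) (F3 j)
    ; simple    = simple
    ; unblocked = λ i≢j z → not-swap⇒saturated i≢j λ m →
        <⇒≢ (arc⇒x>0 (proj₁ (proj₂ (swap∈Π⇒arcs i≢j m)))) (sym z)
    }

-- Cycles of one partition inside another.

module _ {n : ℕ} {I : SF n} {Π Π′ : List (List (Fin n))} (gsp : GSP I Π) (gsp′ : GSP I Π′) where
  open SF I
  open HalfIntegral I
  open Arcs gsp
  open Arcs gsp′ using () renaming
    ( Arc to Arc′; x to y; wf-lookup to wf-lookup′; x>0⇒arc to y>0⇒arc′; arc⇒x>0 to arc⇒y>0; stable to stable′
    ; oneWay⇒arc to oneWay⇒arc′; oneWay-worst to oneWay-worst′; long-worst to long-worst′)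

  fixed-point-invariant : ∀ {r h} → Arc r h h → lookup Π r ∈Π Π′
  fixed-point-invariant {r} {h} hh with y>0⇒arc′ (<-≤-trans (arc⇒x>0 hh) (≮⇒≥ (loops-agree stable stable′)))
  ... | s , hh′ = s , same-cycle (wf-lookup r) (wf-lookup′ s) hh hh′ λ uv uv′ →
    trans (to-h (wf-lookup r) hh uv) (sym (to-h (wf-lookup′ s) hh′ uv′))
    where
    to-h : ∀ {c} → WFCycle c → cyc c h ≡ just h → ∀ {u v} → cyc c u ≡ just v → u ≡ v
    to-h {c} wf e uv = trans (fixed⇒all wf e (cyc⇒∈ c uv)) (sym (fixed⇒all wf e (target∈ wf uv)))

  module LongCycle {r i j} (i≢j : i ≢ j) (ij : Arc r i j) (¬ji : ¬ Arc r j i) where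

    private
      W = wf-lookup r

    arc-oneWay : ∀ {u v} → Arc r u v → OneWay x u v
    arc-oneWay uv with long⇒all-long W i≢j ij ¬ji uv
    ... | u≢v , ¬vu = lone-arc-oneWay u≢v uv ¬vu

    arc-worst : ∀ {u v} → Arc r u v → Saturated x v u
    arc-worst = oneWay-worst ∘ arc-oneWay

    improves : ∀ {u v w} → Arc r u v → Arc r v w → rank v w < rank v u
    improves uv vw = arc-improves uv vw λ { refl → proj₂ (long⇒all-long W i≢j ij ¬ji uv) vw }

    -- `next-common` carries the shared arc round the whole cycle. The predecessor of an agent on
    -- either cycle is then its worst `y`-partner, so the cycles agree.
    shared-arc⇒∈Π′ : ∀ {a b} → Arc r a b → OneWay y a b → lookup Π r ∈Π Π′
    shared-arc⇒∈Π′ {a} {b} ab one with oneWay⇒arc′ one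
    ... | a≢b , s , ab′ , ¬ba′ = s , same-cycle W (wf-lookup′ s) ab ab′ λ uv uv′ → rank-≡
        (long-worst′ a≢b ab′ ¬ba′ uv′ _ (inj₂ (proj₁ (shared uv))))
        (oneWay-worst′ (shared uv) _ (inj₂ (arc⇒y>0 uv′)))
      where
      Shared : Fin n → Set
      Shared u = ∀ {v} → Arc r u v → OneWay y u v
      next : ∀ {u v} → Arc r u v → Shared u → Shared v
      next uv sh vw = next-common stable stable′ (arc-oneWay uv) (sh uv) (arc-worst uv) (oneWay-worst′ (sh uv))
        (arc-oneWay vw) (improves uv vw)
      shared : ∀ {u v} → Arc r u v → OneWay y u v
      shared uv = walk-forward Shared next
        (proj₂ (connected W (cyc⇒∈ (lookup Π r) ab) (cyc⇒∈ (lookup Π r) uv)))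
        (λ av → subst (OneWay y a) (Maybe.just-injective (trans (sym ab) av)) one) uv

    HighAt LowAt : Fin n → Set
    HighAt v = ∃ λ u → Arc r u v × Above y u v
    LowAt  v = ∃ λ u → Arc r u v × Below y u v

    high-low : ∀ {v} → HighAt v → ¬ LowAt v
    high-low (_ , uv , above) (_ , uv′ , below) with cyc-injective W uv uv′
    ... | refl = above-below {y} above below

    -- High and low states alternate along the cycle, so an odd round trip would return to an agent
    -- in the opposite state.
    no-shared-arc⇒even : (∀ {a b} → Arc r a b → ¬ OneWay y a b) → length (lookup Π r) % 2 ≢ 1
    no-shared-arc⇒even ¬shared odd with predecessor W (cyc⇒∈ (lookup Π r) ij)
    ... | p , pi = [ high , [ high , low ]′ ]′
        (map (λ above → p , pi , above) (map (λ above → i , ij , above) (λ below → i , ij , below))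
          (above-or-below {y} stable′ i≢j (improves pi ij) (¬shared ij)))
      where
      down : ∀ {v w} → Arc r v w → HighAt v → LowAt w
      down vw (_ , uv , above) = _ , vw ,
        above⇒below stable stable′ (arc⇒x>0 uv) (arc-oneWay vw) (¬shared vw) above
      up : ∀ {v w} → Arc r v w → LowAt v → HighAt w
      up vw (_ , uv , below) = _ , vw ,
        below⇒above stable stable′ oneWay-worst′ (arc⇒x>0 uv) (arc-worst uv) (arc-oneWay vw) (improves uv vw) below
      high : ∀ {v} → ¬ HighAt v
      high h@(_ , uv , _) = high-low h
        (walk-alternate HighAt LowAt down up (round-trip W (target∈ W uv)) odd h)
      low : ∀ {v} → ¬ LowAt v
      low l@(_ , uv , _) = high-low
        (walk-alternate LowAt HighAt up down (round-trip W (target∈ W uv)) odd l) l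

    odd⇒∈Π′ : length (lookup Π r) % 2 ≡ 1 → lookup Π r ∈Π Π′
    odd⇒∈Π′ odd with any? (λ a → any? (λ b → maps? a b (lookup Π r) ×-dec (0 <? y a b) ×-dec (y b a ≟ℕ 0)))
    ... | yes (_ , _ , ab , one) = shared-arc⇒∈Π′ ab one
    ... | no ¬shared = contradiction odd (no-shared-arc⇒even λ ab one → ¬shared (_ , _ , ab , one))

theorem10 : ∀ {n : ℕ} (I : SF n) (Π Π′ : List (List (Fin n))) →
    GSP I Π → GSP I Π′ →
    ∀ (c : List (Fin n)) → c ∈ Π → length c % 2 ≡ 1 → c ∈Π Π′
theorem10 I Π Π′ gsp gsp′ c c∈Π odd =
  subst (_∈Π Π′) (sym (lookup-index c∈Π)) (go (subst (λ d → length d % 2 ≡ 1) (lookup-index c∈Π) odd))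
  where
  open Arcs gsp
  r = Any.index c∈Π
  go : length (lookup Π r) % 2 ≡ 1 → lookup Π r ∈Π Π′
  go odd with wf-lookup r
  ... | W with successor W (head∈ W)
    where
    head∈ : ∀ {d} (wf : WFCycle d) → proj₁ (proj₂ wf) ∈ d
    head∈ (_ , _ , _ , refl) = here refl
  -- A head mapped to itself means a fixed point; otherwise odd length rules out a transposition and
  -- leaves a cycle of length at least 3.
  ... | b , hb with proj₁ (proj₂ W) ≟ b
  ... | yes refl = fixed-point-invariant gsp gsp′ hb
  ... | no h≢b   = LongCycle.odd⇒∈Π′ gsp gsp′ h≢b hb (odd⇒¬swapped W odd h≢b hb) odd
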